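{- $FUG\equiv_c FLO$, i.e. $FUG\leq_c FLO$ and $FLO\leq_c FUG$.
   Context: All structures are in a finite relational language and have universe a subset of $\omega$; a class of structures consists of structures in a single language and is closed under isomorphism (among structures with universe a subset of $\omega$). $D(\mathcal{A})$ denotes the atomic diagram (atomic sentences and negations of atomic sentences, with elements of $\omega$ as constants, true in $\mathcal{A}$). A computable transformation from $K$ to $K'$ is a c.e. set $\Phi$ of pairs $(\alpha,\varphi)$, $\alpha$ a finite subset of the atomic diagram of a finite structure in the language of $K$, $\varphi$ an atomic sentence or negated atomic sentence in the language of $K'$, such that for each $\mathcal{A}\in K$, $\{\varphi:\exists\alpha\subseteq D(\mathcal{A}),(\alpha,\varphi)\in\Phi\}=D(\mathcal{B})$ for some $\mathcal{B}\in K'$ (write $\Phi(\mathcal{A})=\mathcal{B}$). A computable embedding is a computable transformation with $\mathcal{A}\cong\mathcal{A}'$ iff $\Phi(\mathcal{A})\cong\Phi(\mathcal{A}')$ for all $\mathcal{A},\mathcal{A}'\in K$; $K\leq_c K'$ means a computable embedding of $K$ into $K'$ exists. $FUG$ is the class of finite undirected graphs and $FLO$ the class of finite linear orders. -}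

module Defs where

open import Data.Nat using (ℕ; _≡ᵇ_)
open import Data.Bool using (Bool; true; false)
open import Data.List using (List)
open import Data.List.Membership.Propositional using (_∈_)
open import Data.List.Relation.Unary.All using (All)
open import Data.Maybe using (Maybe; just)
open import Data.Product using (Σ; ∃; _×_; _,_)
open import Data.Sum using (_⊎_)
open import Function.Bundles using (_⇔_)
open import Relation.Binary.PropositionalEquality using (_≡_)

-- A finite structure in a language with a single binary relation symbol
-- (E for graphs, < for linear orders).  The universe is the finite subset
-- of ω consisting of the elements of the list U; R is the interpretation
-- of the relation symbol (its values outside U are irrelevant).
record Str : Set where
  constructor mkStr
  field
    U : List ℕ
    R : ℕ → ℕ → Bool
open Str public

data Atom : Set where
  eqA  : ℕ → ℕ → Atom
  relA : ℕ → ℕ → Atom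

-- A literal: an atom together with a polarity (true = the atom itself,
-- false = its negation).
Lit : Set
Lit = Atom × Bool

-- φ ∈ D(A): the literal mentions only elements of A and is true in A.
Holds : Str → Lit → Set
Holds A (eqA a b , s)  = a ∈ U A × b ∈ U A × ((a ≡ᵇ b) ≡ s)
Holds A (relA a b , s) = a ∈ U A × b ∈ U A × (R A a b ≡ s)

Class : Set₁
Class = Str → Set

record _≅_ (A B : Str) : Set where
  field
    f : ℕ → ℕ
    g : ℕ → ℕ
    f∈ : ∀ a → a ∈ U A → f a ∈ U B
    g∈ : ∀ b → b ∈ U B → g b ∈ U A
    gf : ∀ a → a ∈ U A → g (f a) ≡ a
    fg : ∀ b → b ∈ U B → f (g b) ≡ b
    pres : ∀ a a' → a ∈ U A → a' ∈ U A → R A a a' ≡ R B (f a) (f a')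

FUG : Class
FUG A = (∀ a → a ∈ U A → R A a a ≡ false)
      × (∀ a b → a ∈ U A → b ∈ U A → R A a b ≡ R A b a)

FLO : Class
FLO A = (∀ a → a ∈ U A → R A a a ≡ false)
      × (∀ a b c → a ∈ U A → b ∈ U A → c ∈ U A →
           R A a b ≡ true → R A b c ≡ true → R A a c ≡ true)
      × (∀ a b → a ∈ U A → b ∈ U A →
           (a ≡ b) ⊎ (R A a b ≡ true) ⊎ (R A b a ≡ true))

-- A c.e. set of pairs (α , φ) is given by an enumeration
-- (ℕ → Maybe _, where `nothing` means "nothing enumerated at this stage").
-- Every Agda function is computable, so this is a synthetic rendering of
-- "computably enumerable".
Enum : Set
Enum = ℕ → Maybe (List Lit × Lit)

_∋Φ_ : Enum → List Lit × Lit → Set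
e ∋Φ p = ∃ λ n → e n ≡ just p

Fires : Enum → Str → Lit → Set
Fires e A φ = Σ (List Lit) λ α → (e ∋Φ (α , φ)) × All (Holds A) α

Realizes : Enum → Str → Str → Set
Realizes e A B = ∀ φ → Fires e A φ ⇔ Holds B φ

IsTransformation : Class → Class → Enum → Set
IsTransformation K K' e =
    (∀ α φ → e ∋Φ (α , φ) → Σ Str λ S → All (Holds S) α)
  × (∀ A → K A → Σ Str λ B → K' B × Realizes e A B)

IsEmbedding : Class → Class → Enum → Set
IsEmbedding K K' e =
    IsTransformation K K' e
  × (∀ A A' B B' → K A → K A' → Realizes e A B → Realizes e A' B' →
       (A ≅ A') ⇔ (B ≅ B'))

_≤c_ : Class → Class → Set
K ≤c K' = Σ Enum λ e → IsEmbedding K K' e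

-- FLO ≤c FUG: a linear order goes to the edgeless graph on its universe; the
-- graph records only the size, and finite linear orders of equal size are
-- isomorphic (sorted enumerations have equal profiles).
--
-- FUG ≤c FLO, indeed K ≤c FLO for every class K: A goes to its cells (t , i),
-- t a duplicate-free tuple of A and i < weight (code t), where code t encodes
-- the profile (ordered isomorphism type) of t, ordered as natural numbers.
-- Isomorphic structures have equally many cells; conversely the number of
-- cells lies in [weight M , weight (M+1)) for M the largest code, attained by
-- a tuple listing all of A, so it determines M and hence A up to isomorphism.
module Submission where

open import Defs

open import Data.Bool using (Bool; true; false; T; T?)
open import Data.Bool.Properties using (T-≡)
open import Data.Empty using (⊥; ⊥-elim)
open import Data.Maybe using (Maybe; just; nothing)
open import Data.Nat using (ℕ; zero; suc; _+_; _*_; _∸_; _≤_; _<_; _≡ᵇ_; _<ᵇ_; z≤n; s≤s; NonZero; >-nonZero⁻¹)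
open import Data.Nat.Properties
  using (_≟_; _<?_; suc-injective; ≤-antisym; ≤-refl; ≤-reflexive; ≤-trans; <⇒≤; <-irrefl; <-trans;
         <-≤-trans; <-cmp; m≤n⇒m<n∨m≡n; n≤1+n; m≤m+n; m≤n+m; m≤n*m; *-mono-≤; *-monoˡ-≤;
         +-suc; +-identityʳ; +-comm; n∸n≡0; m+n∸m≡n; ≡⇒≡ᵇ; <⇒<ᵇ; <ᵇ⇒<; ≤-totalOrder; module ≤-Reasoning)
open import Data.Product using (Σ; _×_; _,_; proj₁; proj₂)
open import Data.Product.Properties using (≡-dec)
open import Data.Sum as Sum using (_⊎_; inj₁; inj₂)
open import Data.Unit using (⊤; tt)
open import Data.List
  using (List; []; _∷_; _++_; length; map; foldr; replicate; concatMap; filter; upTo; cartesianProduct;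
         deduplicate)
open import Data.List.Properties
  using (length-++; length-map; length-filter; length-upTo; map-∘; map-id; map-id-local; map-cong-local;
         ∷-injective)
open import Data.List.Extrema ≤-totalOrder using (argmax; argmax-all; f[xs]≤f[argmax])
open import Data.List.Membership.Propositional using (_∈_; _∉_; lose; find)
open import Data.List.Membership.Propositional.Properties
  using (∈-++⁺ˡ; ∈-++⁺ʳ; ∈-map⁺; ∈-map⁻; ∈-concatMap⁺; ∈-concatMap⁻; ∈-filter⁺; ∈-filter⁻; ∈-upTo⁺;
         ∈-upTo⁻; ∈-cartesianProduct⁺; ∈-cartesianProduct⁻; ∈-deduplicate⁺; ∈-deduplicate⁻)
open import Data.List.Membership.DecPropositional _≟_ using (_∈?_)
open import Data.List.Membership.DecPropositional (≡-dec _≟_ _≟_) using () renaming (_∈?_ to _∈²?_)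
open import Data.List.Relation.Unary.Any using (here; there)
open import Data.List.Relation.Unary.All using (All; []; _∷_)
import Data.List.Relation.Unary.All as All
import Data.List.Relation.Unary.All.Properties as All
open import Data.List.Relation.Unary.AllPairs using (AllPairs; []; _∷_)
open import Data.List.Relation.Unary.Unique.Propositional using (Unique)
import Data.List.Relation.Unary.Unique.Propositional.Properties as Unique
open import Data.List.Relation.Unary.Unique.DecPropositional _≟_ using (unique?)
open import Data.List.Relation.Unary.Unique.DecPropositional.Properties using (deduplicate-!)
open import Function.Bundles using (_⇔_; mk⇔; Equivalence)
open import Relation.Binary.Definitions using (tri<; tri≈; tri>)
open import Relation.Binary.PropositionalEquality
open import Relation.Nullary using (yes; no; does)
open import Relation.Nullary.Decidable using (_×-dec_)
open import Relation.Unary using (Decidable)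

triangle : ℕ → ℕ
triangle zero    = 0
triangle (suc n) = suc n + triangle n

pair : ℕ → ℕ → ℕ
pair a b = triangle (a + b) + a

nextPair : ℕ × ℕ → ℕ × ℕ
nextPair (a , zero)  = (0 , suc a)
nextPair (a , suc b) = (suc a , b)

unpair : ℕ → ℕ × ℕ
unpair zero    = (0 , 0)
unpair (suc n) = nextPair (unpair n)

private
  ∸-suc : ∀ s a → a < s → s ∸ a ≡ suc (s ∸ suc a)
  ∸-suc (suc s) zero    _       = refl
  ∸-suc (suc s) (suc a) (s≤s p) = ∸-suc s a p

unpair-diagonal : ∀ s a → a ≤ s → unpair (triangle s + a) ≡ (a , s ∸ a)
unpair-diagonal zero    zero    _ = refl
unpair-diagonal (suc s) zero    _ = begin
  unpair (suc s + triangle s + 0)   ≡⟨ cong unpair (+-identityʳ (suc s + triangle s)) ⟩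
  unpair (suc (s + triangle s))     ≡⟨ cong (λ n → unpair (suc n)) (+-comm s (triangle s)) ⟩
  nextPair (unpair (triangle s + s)) ≡⟨ cong nextPair (unpair-diagonal s s ≤-refl) ⟩
  nextPair (s , s ∸ s)              ≡⟨ cong (λ k → nextPair (s , k)) (n∸n≡0 s) ⟩
  (0 , suc s)                       ∎
  where open ≡-Reasoning
unpair-diagonal s (suc a) a<s = begin
  unpair (triangle s + suc a)       ≡⟨ cong unpair (+-suc (triangle s) a) ⟩
  nextPair (unpair (triangle s + a)) ≡⟨ cong nextPair (unpair-diagonal s a (≤-trans (n≤1+n a) a<s)) ⟩
  nextPair (a , s ∸ a)              ≡⟨ cong (λ k → nextPair (a , k)) (∸-suc s a a<s) ⟩
  (suc a , s ∸ suc a)               ∎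
  where open ≡-Reasoning

unpair-pair : ∀ a b → unpair (pair a b) ≡ (a , b)
unpair-pair a b =
  trans (unpair-diagonal (a + b) a (m≤m+n a b)) (cong (a ,_) (m+n∸m≡n a b))

triangle-≥ : ∀ n → n ≤ triangle n
triangle-≥ zero    = z≤n
triangle-≥ (suc n) = m≤m+n (suc n) (triangle n)

pair-≥ʳ : ∀ a b → b ≤ pair a b
pair-≥ʳ a b = ≤-trans (m≤n+m b a)
  (≤-trans (triangle-≥ (a + b)) (m≤m+n (triangle (a + b)) a))

-- A type is encodable when it embeds into ℕ with a computable left inverse;
-- enumerations of finite data are obtained by decoding every n : ℕ.

record Encodable (X : Set) : Set where
  field
    encode        : X → ℕ
    decode        : ℕ → X
    decode-encode : ∀ x → decode (encode x) ≡ x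

  encode-injective : ∀ {x y} → encode x ≡ encode y → x ≡ y
  encode-injective {x} {y} e =
    trans (sym (decode-encode x)) (trans (cong decode e) (decode-encode y))

open Encodable {{...}} public

instance
  ℕ-encodable : Encodable ℕ
  ℕ-encodable = record { encode = λ n → n ; decode = λ n → n ; decode-encode = λ _ → refl }

  Bool-encodable : Encodable Bool
  Bool-encodable = record { encode = enc ; decode = dec ; decode-encode = λ { false → refl ; true → refl } }
    where
    enc : Bool → ℕ
    enc false = 0
    enc true  = 1
    dec : ℕ → Bool
    dec zero    = false
    dec (suc _) = true

  ×-encodable : {X Y : Set} {{_ : Encodable X}} {{_ : Encodable Y}} → Encodable (X × Y)
  ×-encodable {X} {Y} = record { encode = enc ; decode = dec ; decode-encode = dec-enc }
    where
    enc : X × Y → ℕ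
    enc (x , y) = pair (encode x) (encode y)
    dec : ℕ → X × Y
    dec n = decode (proj₁ (unpair n)) , decode (proj₂ (unpair n))
    dec-enc : ∀ p → dec (enc p) ≡ p
    dec-enc (x , y) rewrite unpair-pair (encode x) (encode y) =
      cong₂ _,_ (decode-encode x) (decode-encode y)

-- Lists are encoded as iterated pairs; the encoding of x ∷ xs exceeds that
-- of xs, which bounds the number of decoding steps.
encodeList : {X : Set} → (X → ℕ) → List X → ℕ
encodeList enc []       = 0
encodeList enc (x ∷ xs) = suc (pair (enc x) (encodeList enc xs))

decodeListWithin : {X : Set} → (ℕ → X) → ℕ → ℕ → List X
decodeListWithin dec zero       _       = []
decodeListWithin dec (suc fuel) zero    = []
decodeListWithin dec (suc fuel) (suc n) =
  dec (proj₁ (unpair n)) ∷ decodeListWithin dec fuel (proj₂ (unpair n))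

encodeList-step : {X : Set} (enc : X → ℕ) (x : X) (xs : List X) →
                  encodeList enc xs < encodeList enc (x ∷ xs)
encodeList-step enc x xs = s≤s (pair-≥ʳ (enc x) (encodeList enc xs))

length≤encodeList : {X : Set} (enc : X → ℕ) (xs : List X) → length xs ≤ encodeList enc xs
length≤encodeList enc []       = z≤n
length≤encodeList enc (x ∷ xs) = ≤-trans (s≤s (length≤encodeList enc xs)) (encodeList-step enc x xs)

decodeListWithin-encodeList : {X : Set} (enc : X → ℕ) (dec : ℕ → X) → (∀ x → dec (enc x) ≡ x) →
  ∀ fuel xs → encodeList enc xs ≤ fuel → decodeListWithin dec fuel (encodeList enc xs) ≡ xs
decodeListWithin-encodeList enc dec dec-enc zero       []       _ = refl
decodeListWithin-encodeList enc dec dec-enc (suc fuel) []       _ = refl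
decodeListWithin-encodeList enc dec dec-enc (suc fuel) (x ∷ xs) (s≤s p)
  rewrite unpair-pair (enc x) (encodeList enc xs) =
  cong₂ _∷_ (dec-enc x) (decodeListWithin-encodeList enc dec dec-enc fuel xs
                           (≤-trans (pair-≥ʳ (enc x) (encodeList enc xs)) p))

instance
  List-encodable : {X : Set} {{_ : Encodable X}} → Encodable (List X)
  List-encodable {{E}} = record
    { encode        = encodeList (Encodable.encode E)
    ; decode        = λ n → decodeListWithin (Encodable.decode E) n n
    ; decode-encode = λ xs → decodeListWithin-encodeList (Encodable.encode E) (Encodable.decode E)
                               (Encodable.decode-encode E) _ xs ≤-refl
    }

-- A c.e. set of pairs (α , φ) given by a decidable family of queries over an
-- encodable type: each valid query q contributes (premises q , conclusion q).

module QueryEnumeration {Q : Set} {{_ : Encodable Q}} {Valid : Q → Set} (valid? : Decidable Valid)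
                        (premises : Q → List Lit) (conclusion : Q → Lit) where

  emit : Q → Maybe (List Lit × Lit)
  emit q with valid? q
  ... | yes _ = just (premises q , conclusion q)
  ... | no  _ = nothing

  enumeration : Enum
  enumeration n = emit (decode n)

  emitted⇒valid : ∀ q {p} → emit q ≡ just p → Valid q × (premises q , conclusion q) ≡ p
  emitted⇒valid q e with valid? q
  emitted⇒valid q refl | yes v = v , refl
  emitted⇒valid q ()   | no  _

  valid⇒emitted : ∀ q → Valid q → emit q ≡ just (premises q , conclusion q)
  valid⇒emitted q v with valid? q
  ... | yes _  = refl
  ... | no  ¬v = ⊥-elim (¬v v)

  fires-sound : ∀ A φ → Fires enumeration A φ →
                Σ Q λ q → Valid q × All (Holds A) (premises q) × conclusion q ≡ φ
  fires-sound A φ (α , (n , e) , holds) with emitted⇒valid (decode n) e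
  ... | v , refl = decode n , v , holds , refl

  fires-complete : ∀ A q → Valid q → All (Holds A) (premises q) → Fires enumeration A (conclusion q)
  fires-complete A q v holds =
    premises q , (encode q , trans (cong emit (decode-encode q)) (valid⇒emitted q v)) , holds

  satisfiable : (∀ q → Valid q → Σ Str λ S → All (Holds S) (premises q)) →
                ∀ α φ → enumeration ∋Φ (α , φ) → Σ Str λ S → All (Holds S) α
  satisfiable sat α φ (n , e) with emitted⇒valid (decode n) e
  ... | v , refl = sat (decode n) v

source target : Atom → ℕ
source (eqA a _)  = a
source (relA a _) = a
target (eqA _ b)  = b
target (relA _ b) = b

isEq : Atom → Bool
isEq (eqA _ _)  = true
isEq (relA _ _) = false

atomOf : Bool → ℕ → ℕ → Atom
atomOf true  = eqA
atomOf false = relA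

atomOf-eta : ∀ at → atomOf (isEq at) (source at) (target at) ≡ at
atomOf-eta (eqA _ _)  = refl
atomOf-eta (relA _ _) = refl

truthWith : (ℕ → ℕ → Bool) → Atom → Bool
truthWith r (eqA a b)  = a ≡ᵇ b
truthWith r (relA a b) = r a b

holds-elim : ∀ S at s → Holds S (at , s) →
             source at ∈ U S × target at ∈ U S × truthWith (R S) at ≡ s
holds-elim S (eqA _ _)  s h = h
holds-elim S (relA _ _) s h = h

≡ᵇ-refl : ∀ n → (n ≡ᵇ n) ≡ true
≡ᵇ-refl n = Equivalence.to T-≡ (≡⇒≡ᵇ n n refl)

literalAt : (ℕ → ℕ → Bool) → Bool → ℕ → ℕ → Lit
literalAt r k a b = (atomOf k a b , truthWith r (atomOf k a b))

holds-literalAt : ∀ S k {a b} → a ∈ U S → b ∈ U S → Holds S (literalAt (R S) k a b)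
holds-literalAt S true  a∈ b∈ = a∈ , b∈ , refl
holds-literalAt S false a∈ b∈ = a∈ , b∈ , refl

literal-eta : ∀ S {at s} → Holds S (at , s) →
              literalAt (R S) (isEq at) (source at) (target at) ≡ (at , s)
literal-eta S {at} {s} h rewrite atomOf-eta at = cong (at ,_) (proj₂ (proj₂ (holds-elim S at s h)))

-- The literal a = a, which holds in S exactly when a is an element of S.
isElement : ℕ → Lit
isElement a = (eqA a a , true)

isElement-intro : ∀ S {a} → a ∈ U S → Holds S (isElement a)
isElement-intro S {a} a∈ = a∈ , a∈ , ≡ᵇ-refl a

≅-sym : ∀ {A B} → A ≅ B → B ≅ A
≅-sym {A} {B} i = record
  { f = g ; g = f ; f∈ = g∈ ; g∈ = f∈ ; gf = fg ; fg = gf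
  ; pres = λ b b' p p' → begin
      R B b b'                 ≡⟨ cong₂ (R B) (fg b p) (fg b' p') ⟨
      R B (f (g b)) (f (g b')) ≡⟨ pres (g b) (g b') (g∈ b p) (g∈ b' p') ⟨
      R A (g b) (g b')         ∎
  }
  where open _≅_ i
        open ≡-Reasoning

≅-trans : ∀ {A B C} → A ≅ B → B ≅ C → A ≅ C
≅-trans i j = record
  { f    = λ a → J.f (I.f a)
  ; g    = λ c → I.g (J.g c)
  ; f∈   = λ a p → J.f∈ _ (I.f∈ a p)
  ; g∈   = λ c p → I.g∈ _ (J.g∈ c p)
  ; gf   = λ a p → trans (cong I.g (J.gf _ (I.f∈ a p))) (I.gf a p)
  ; fg   = λ c p → trans (cong J.f (I.fg _ (J.g∈ c p))) (J.fg c p)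
  ; pres = λ a a' p p' → trans (I.pres a a' p p') (J.pres _ _ (I.f∈ a p) (I.f∈ a' p'))
  }
  where module I = _≅_ i
        module J = _≅_ j

sameDiagram⇒≅ : ∀ {B C} → (∀ φ → Holds B φ → Holds C φ) → (∀ φ → Holds C φ → Holds B φ) →
                B ≅ C
sameDiagram⇒≅ {B} {C} B⇒C C⇒B = record
  { f = λ a → a ; g = λ a → a
  ; f∈ = λ a p → proj₁ (B⇒C (isElement a) (isElement-intro B p))
  ; g∈ = λ a p → proj₁ (C⇒B (isElement a) (isElement-intro C p))
  ; gf = λ _ _ → refl ; fg = λ _ _ → refl
  ; pres = λ a a' p p' → sym (proj₂ (proj₂ (B⇒C (relA a a' , R B a a') (p , p' , refl))))
  }

realizations-≅ : ∀ e A {B C} → Realizes e A B → Realizes e A C → B ≅ C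
realizations-≅ e A rB rC = sameDiagram⇒≅
  (λ φ h → Equivalence.to (rC φ) (Equivalence.from (rB φ) h))
  (λ φ h → Equivalence.to (rB φ) (Equivalence.from (rC φ) h))

-- To show that e is a computable embedding it suffices to exhibit, for each
-- structure of K, one image Φ₀ A in K' and to check that Φ₀ reflects and
-- preserves isomorphism: every other image is isomorphic to Φ₀ A.
embedding-via-image : ∀ {K K'} (e : Enum) (Φ₀ : Str → Str) →
  (∀ α φ → e ∋Φ (α , φ) → Σ Str λ S → All (Holds S) α) →
  (∀ A → K A → K' (Φ₀ A) × Realizes e A (Φ₀ A)) →
  (∀ A A' → K A → K A' → (A ≅ A') ⇔ (Φ₀ A ≅ Φ₀ A')) →
  IsEmbedding K K' e
embedding-via-image e Φ₀ sat image iso⇔ =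
  (sat , λ A k → Φ₀ A , image A k) ,
  λ A A' B B' k k' r r' →
    let B≅ΦA   = realizations-≅ e A r (proj₂ (image A k))
        B'≅ΦA' = realizations-≅ e A' r' (proj₂ (image A' k'))
    in mk⇔ (λ i → ≅-trans B≅ΦA (≅-trans (Equivalence.to (iso⇔ A A' k k') i) (≅-sym B'≅ΦA')))
           (λ j → Equivalence.from (iso⇔ A A' k k') (≅-trans (≅-sym B≅ΦA) (≅-trans j B'≅ΦA')))

dedup : List ℕ → List ℕ
dedup = deduplicate _≟_

∣_∣ : Str → ℕ
∣ A ∣ = length (dedup (U A))

remove : ℕ → List ℕ → List ℕ
remove y []       = []
remove y (z ∷ zs) with y ≟ z
... | yes _ = zs
... | no  _ = z ∷ remove y zs

length-remove : ∀ {y} ys → y ∈ ys → suc (length (remove y ys)) ≡ length ys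
length-remove {y} (z ∷ zs) p with y ≟ z
length-remove {y} (z ∷ zs) p          | yes _   = refl
length-remove {y} (z ∷ zs) (here y≡z) | no  y≢z = ⊥-elim (y≢z y≡z)
length-remove {y} (z ∷ zs) (there p)  | no  _   = cong suc (length-remove zs p)

∈-remove : ∀ {a y} ys → a ∈ ys → a ≢ y → a ∈ remove y ys
∈-remove {a} {y} (z ∷ zs) p a≢y with y ≟ z
∈-remove {a} {y} (z ∷ zs) (here refl) a≢y | yes refl = ⊥-elim (a≢y refl)
∈-remove {a} {y} (z ∷ zs) (there p)   a≢y | yes _    = p
∈-remove {a} {y} (z ∷ zs) (here e)    a≢y | no  _    = here e
∈-remove {a} {y} (z ∷ zs) (there p)   a≢y | no  _    = there (∈-remove zs p a≢y)

pigeonhole : ∀ {xs ys} (f : ℕ → ℕ) → Unique xs →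
             (∀ {a b} → a ∈ xs → b ∈ xs → f a ≡ f b → a ≡ b) →
             (∀ {a} → a ∈ xs → f a ∈ ys) → length xs ≤ length ys
pigeonhole {[]}     f _              _   _    = z≤n
pigeonhole {x ∷ xs} {ys} f (x∉xs ∷ !xs) inj into =
  subst (suc (length xs) ≤_) (length-remove ys (into (here refl)))
    (s≤s (pigeonhole f !xs (λ p q → inj (there p) (there q)) into-rest))
  where
  into-rest : ∀ {a} → a ∈ xs → f a ∈ remove (f x) ys
  into-rest {a} p = ∈-remove ys (into (there p))
    (λ fa≡fx → All.lookup x∉xs p (sym (inj (there p) (here refl) fa≡fx)))

map-unique : ∀ (f : ℕ → ℕ) {t} → Unique t → (∀ {a b} → a ∈ t → b ∈ t → f a ≡ f b → a ≡ b) →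
             Unique (map f t)
map-unique f []          _   = []
map-unique f (x∉ ∷ !t) inj =
  All.map⁺ (All.tabulate λ p fx≡fy → All.lookup x∉ p (inj (here refl) (there p) fx≡fy))
  ∷ map-unique f !t (λ p q → inj (there p) (there q))

record Bijection (V W : List ℕ) : Set where
  field
    to   : ℕ → ℕ
    from : ℕ → ℕ
    to∈   : ∀ {a} → a ∈ V → to a ∈ W
    from∈ : ∀ {b} → b ∈ W → from b ∈ V
    from-to : ∀ {a} → a ∈ V → from (to a) ≡ a
    to-from : ∀ {b} → b ∈ W → to (from b) ≡ b

bijection⇒dedup-length : ∀ {V W} → Bijection V W → length (dedup V) ≡ length (dedup W)
bijection⇒dedup-length {V} {W} bij = ≤-antisym
  (pigeonhole to (deduplicate-! _≟_ V)
    (λ p q e → trans (sym (from-to (dedup⁻ p))) (trans (cong from e) (from-to (dedup⁻ q))))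
    (λ p → dedup⁺ (to∈ (dedup⁻ p))))
  (pigeonhole from (deduplicate-! _≟_ W)
    (λ p q e → trans (sym (to-from (dedup⁻ p))) (trans (cong to e) (to-from (dedup⁻ q))))
    (λ p → dedup⁺ (from∈ (dedup⁻ p))))
  where
  open Bijection bij
  dedup⁻ : ∀ {a xs} → a ∈ dedup xs → a ∈ xs
  dedup⁻ {xs = xs} = ∈-deduplicate⁻ _≟_ xs
  dedup⁺ : ∀ {a xs} → a ∈ xs → a ∈ dedup xs
  dedup⁺ = ∈-deduplicate⁺ _≟_

≅⇒∣∣≡ : ∀ {A B} → A ≅ B → ∣ A ∣ ≡ ∣ B ∣
≅⇒∣∣≡ i = bijection⇒dedup-length record
  { to = f ; from = g ; to∈ = f∈ _ ; from∈ = g∈ _ ; from-to = gf _ ; to-from = fg _ }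
  where open _≅_ i

link : (ℕ → ℕ → Bool) → ℕ → ℕ → Bool × Bool
link r x y = (r x y , r y x)

Profile : Set
Profile = List (Bool × List (Bool × Bool))

-- The profile of a tuple x₁ … xₙ records r xᵢ xᵢ and the links from xᵢ to
-- every later xⱼ.  Equal profiles mean that xᵢ ↦ yᵢ preserves the relation.
profile : (ℕ → ℕ → Bool) → List ℕ → Profile
profile r []      = []
profile r (x ∷ s) = (r x x , map (link r x) s) ∷ profile r s

length-profile : ∀ r t → length (profile r t) ≡ length t
length-profile r []      = refl
length-profile r (x ∷ s) = cong suc (length-profile r s)

profile-map : ∀ r r' (f : ℕ → ℕ) t → (∀ {a b} → a ∈ t → b ∈ t → r a b ≡ r' (f a) (f b)) →
              profile r' (map f t) ≡ profile r t
profile-map r r' f []      h = refl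
profile-map r r' f (x ∷ s) h =
  cong₂ _∷_ (cong₂ _,_ (sym (h (here refl) (here refl))) links)
            (profile-map r r' f s (λ p q → h (there p) (there q)))
  where
  links : map (link r' (f x)) (map f s) ≡ map (link r x) s
  links = trans (sym (map-∘ s)) (map-cong-local (All.tabulate λ p →
            sym (cong₂ _,_ (h (here refl) (there p)) (h (there p) (here refl)))))

profile-cong : ∀ r r' t → (∀ {a b} → a ∈ t → b ∈ t → r a b ≡ r' a b) → profile r t ≡ profile r' t
profile-cong r r' t h = trans (sym (profile-map r r' (λ a → a) t h)) (cong (profile r') (map-id t))

transfer : List ℕ → List ℕ → ℕ → ℕ
transfer []      _        a = a
transfer (x ∷ s) []       a = a
transfer (x ∷ s) (y ∷ s') a with a ≟ x
... | yes _ = y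
... | no  _ = transfer s s' a

private
  ∈-tail : ∀ {a x : ℕ} {s} → a ∈ x ∷ s → a ≢ x → a ∈ s
  ∈-tail (here a≡x) a≢x = ⊥-elim (a≢x a≡x)
  ∈-tail (there p)  _   = p

transfer-∈ : ∀ {t t' a} → length t ≡ length t' → a ∈ t → transfer t t' a ∈ t'
transfer-∈ {x ∷ s} {y ∷ s'} {a} len p with a ≟ x
... | yes _   = here refl
... | no  a≢x = there (transfer-∈ (suc-injective len) (∈-tail p a≢x))

transfer-inverse : ∀ {t t' a} → Unique t → Unique t' → length t ≡ length t' → a ∈ t →
                   transfer t' t (transfer t t' a) ≡ a
transfer-inverse {x ∷ s} {y ∷ s'} {a} _ (y∉s' ∷ _) len p with a ≟ x
transfer-inverse {x ∷ s} {y ∷ s'} {a} _ _ len p | yes refl with y ≟ y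
... | yes _   = refl
... | no  y≢y = ⊥-elim (y≢y refl)
transfer-inverse {x ∷ s} {y ∷ s'} {a} (_ ∷ !s) (y∉s' ∷ !s') len p | no a≢x
  with transfer s s' a ≟ y
... | yes b≡y = ⊥-elim (All.lookup y∉s' (transfer-∈ (suc-injective len) (∈-tail p a≢x)) (sym b≡y))
... | no  _   = transfer-inverse !s !s' (suc-injective len) (∈-tail p a≢x)

map-transfer : ∀ {B : Set} {g g' : ℕ → B} s s' {b} → map g s ≡ map g' s' → b ∈ s →
               g b ≡ g' (transfer s s' b)
map-transfer (x ∷ s) (y ∷ s') {b} e p with ∷-injective e | b ≟ x
... | gx≡gy , _  | yes refl = gx≡gy
... | _ , rest   | no b≢x   = map-transfer s s' rest (∈-tail p b≢x)

transfer-pres : ∀ r r' t t' {a b} → profile r t ≡ profile r' t' → a ∈ t → b ∈ t →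
                r a b ≡ r' (transfer t t' a) (transfer t t' b)
transfer-pres r r' (x ∷ s) (y ∷ s') {a} {b} e pa pb
  with ∷-injective e | a ≟ x | b ≟ x
... | head , _    | yes refl | yes refl = cong proj₁ head
... | head , _    | yes refl | no b≢x   =
  cong proj₁ (map-transfer s s' (cong proj₂ head) (∈-tail pb b≢x))
... | head , _    | no a≢x   | yes refl =
  cong proj₂ (map-transfer s s' (cong proj₂ head) (∈-tail pa a≢x))
... | _ , rest    | no a≢x   | no b≢x   =
  transfer-pres r r' s s' rest (∈-tail pa a≢x) (∈-tail pb b≢x)

Enumerates : Str → List ℕ → Set
Enumerates A t = (∀ {a} → a ∈ U A → a ∈ t) × (∀ {a} → a ∈ t → a ∈ U A)

profile-iso : ∀ {A B t t'} → Enumerates A t → Unique t → Enumerates B t' → Unique t' →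
              profile (R A) t ≡ profile (R B) t' → A ≅ B
profile-iso {A} {B} {t} {t'} (A⊆t , t⊆A) !t (B⊆t' , t'⊆B) !t' e = record
  { f = transfer t t' ; g = transfer t' t
  ; f∈ = λ a p → t'⊆B (transfer-∈ len (A⊆t p))
  ; g∈ = λ b p → t⊆A (transfer-∈ (sym len) (B⊆t' p))
  ; gf = λ a p → transfer-inverse !t !t' len (A⊆t p)
  ; fg = λ b p → transfer-inverse !t' !t (sym len) (B⊆t' p)
  ; pres = λ a a' p p' → transfer-pres (R A) (R B) t t' e (A⊆t p) (A⊆t p')
  }
  where
  len : length t ≡ length t'
  len = trans (sym (length-profile (R A) t)) (trans (cong length e) (length-profile (R B) t'))

insert : (ℕ → ℕ → Bool) → ℕ → List ℕ → List ℕ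
insert r x []      = x ∷ []
insert r x (h ∷ s) with r x h
... | true  = x ∷ h ∷ s
... | false = h ∷ insert r x s

sort : (ℕ → ℕ → Bool) → List ℕ → List ℕ
sort r = foldr (insert r) []

∈-insert⁻ : ∀ r x s {a} → a ∈ insert r x s → a ≡ x ⊎ a ∈ s
∈-insert⁻ r x []      (here a≡x) = inj₁ a≡x
∈-insert⁻ r x (h ∷ s) p with r x h
∈-insert⁻ r x (h ∷ s) (here a≡x) | true  = inj₁ a≡x
∈-insert⁻ r x (h ∷ s) (there p)  | true  = inj₂ p
∈-insert⁻ r x (h ∷ s) (here a≡h) | false = inj₂ (here a≡h)
∈-insert⁻ r x (h ∷ s) (there p)  | false = Sum.map₂ there (∈-insert⁻ r x s p)

∈-insert⁺ : ∀ r x s {a} → a ≡ x ⊎ a ∈ s → a ∈ insert r x s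
∈-insert⁺ r x []      (inj₁ a≡x) = here a≡x
∈-insert⁺ r x (h ∷ s) p with r x h
∈-insert⁺ r x (h ∷ s) (inj₁ a≡x)         | true  = here a≡x
∈-insert⁺ r x (h ∷ s) (inj₂ p)           | true  = there p
∈-insert⁺ r x (h ∷ s) (inj₁ a≡x)         | false = there (∈-insert⁺ r x s (inj₁ a≡x))
∈-insert⁺ r x (h ∷ s) (inj₂ (here a≡h))  | false = here a≡h
∈-insert⁺ r x (h ∷ s) (inj₂ (there p))   | false = there (∈-insert⁺ r x s (inj₂ p))

length-insert : ∀ r x s → length (insert r x s) ≡ suc (length s)
length-insert r x []      = refl
length-insert r x (h ∷ s) with r x h
... | true  = refl
... | false = cong suc (length-insert r x s)

length-sort : ∀ r xs → length (sort r xs) ≡ length xs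
length-sort r []       = refl
length-sort r (x ∷ xs) = trans (length-insert r x (sort r xs)) (cong suc (length-sort r xs))

∈-sort⁻ : ∀ r xs {a} → a ∈ sort r xs → a ∈ xs
∈-sort⁻ r (x ∷ xs) p with ∈-insert⁻ r x (sort r xs) p
... | inj₁ refl = here refl
... | inj₂ q    = there (∈-sort⁻ r xs q)

∈-sort⁺ : ∀ r xs {a} → a ∈ xs → a ∈ sort r xs
∈-sort⁺ r (x ∷ xs) (here a≡x) = ∈-insert⁺ r x (sort r xs) (inj₁ a≡x)
∈-sort⁺ r (x ∷ xs) (there p)  = ∈-insert⁺ r x (sort r xs) (inj₂ (∈-sort⁺ r xs p))

Sorted : Str → List ℕ → Set
Sorted A = AllPairs (λ a b → R A a b ≡ true)

asymmetric : ∀ {A a b} → FLO A → a ∈ U A → b ∈ U A → R A a b ≡ true → R A b a ≡ false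
asymmetric {A} {a} {b} (irr , trans< , _) a∈ b∈ a<b with R A b a in b<a
... | false = refl
... | true  with () ← trans (sym (trans< a b a a∈ b∈ a∈ a<b b<a)) (irr a a∈)

insert-sorted : ∀ {A x s} → FLO A → x ∈ U A → (∀ {b} → b ∈ s → b ∈ U A) → x ∉ s →
                Sorted A s → Sorted A (insert (R A) x s)
insert-sorted {s = []} _ _ _ _ _ = [] ∷ []
insert-sorted {A} {x} {h ∷ s} lo@(_ , trans< , total) x∈ s⊆ x∉ (h<s ∷ sorted) with R A x h in x<h
... | true  = (x<h ∷ All.tabulate λ p →
                trans< _ _ _ x∈ (s⊆ (here refl)) (s⊆ (there p)) x<h (All.lookup h<s p))
              ∷ h<s ∷ sorted
... | false = All.tabulate h<inserted
              ∷ insert-sorted lo x∈ (λ p → s⊆ (there p)) (λ p → x∉ (there p)) sorted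
  where
  h<inserted : ∀ {b} → b ∈ insert (R A) x s → R A h b ≡ true
  h<inserted p with ∈-insert⁻ (R A) x s p
  ... | inj₂ q    = All.lookup h<s q
  ... | inj₁ refl with total x h x∈ (s⊆ (here refl))
  ...   | inj₁ refl        = ⊥-elim (x∉ (here refl))
  ...   | inj₂ (inj₁ x<h') with () ← trans (sym x<h') x<h
  ...   | inj₂ (inj₂ h<x)  = h<x

sort-sorted : ∀ {A} xs → FLO A → Unique xs → (∀ {b} → b ∈ xs → b ∈ U A) →
              Sorted A (sort (R A) xs)
sort-sorted []       _  _            _   = []
sort-sorted {A} (x ∷ xs) lo (x∉xs ∷ !xs) xs⊆ =
  insert-sorted lo (xs⊆ (here refl)) (λ p → xs⊆ (there (∈-sort⁻ (R A) xs p)))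
    (λ p → All.lookup x∉xs (∈-sort⁻ (R A) xs p) refl)
    (sort-sorted xs lo !xs (λ p → xs⊆ (there p)))

-- The profile of every sorted tuple of length n.
chain : ℕ → Profile
chain zero    = []
chain (suc n) = (false , replicate n (true , false)) ∷ chain n

map-constant : ∀ {B : Set} {g : ℕ → B} {c : B} {s} → All (λ y → g y ≡ c) s →
               map g s ≡ replicate (length s) c
map-constant []         = refl
map-constant (gy≡c ∷ h) = cong₂ _∷_ gy≡c (map-constant h)

sorted-profile : ∀ {A} s → FLO A → (∀ {b} → b ∈ s → b ∈ U A) → Sorted A s →
                 profile (R A) s ≡ chain (length s)
sorted-profile []       _  _  _                = refl
sorted-profile (x ∷ s) lo s⊆ (x<s ∷ sorted) =
  cong₂ _∷_ (cong₂ _,_ (proj₁ lo x (s⊆ (here refl)))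
                       (map-constant (All.tabulate λ p →
                          cong₂ _,_ (All.lookup x<s p)
                                    (asymmetric lo (s⊆ (here refl)) (s⊆ (there p)) (All.lookup x<s p)))))
            (sorted-profile s lo (λ p → s⊆ (there p)) sorted)

sorted-unique : ∀ {A} s → FLO A → (∀ {b} → b ∈ s → b ∈ U A) → Sorted A s → Unique s
sorted-unique []      _  _  _                = []
sorted-unique {A} (x ∷ s) lo s⊆ (x<s ∷ sorted) =
  All.tabulate (λ p x≡b → x≮x (subst (λ b → R A x b ≡ true) (sym x≡b) (All.lookup x<s p)))
  ∷ sorted-unique s lo (λ p → s⊆ (there p)) sorted
  where
  x≮x : R A x x ≡ true → ⊥
  x≮x x<x with () ← trans (sym x<x) (proj₁ lo x (s⊆ (here refl)))

sortedElements : Str → List ℕ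
sortedElements A = sort (R A) (dedup (U A))

sortedElements-enumerates : ∀ A → Enumerates A (sortedElements A)
sortedElements-enumerates A =
  (λ p → ∈-sort⁺ (R A) _ (∈-deduplicate⁺ _≟_ p)) ,
  (λ p → ∈-deduplicate⁻ _≟_ (U A) (∈-sort⁻ (R A) _ p))

sortedElements-sorted : ∀ {A} → FLO A → Sorted A (sortedElements A)
sortedElements-sorted {A} lo =
  sort-sorted (dedup (U A)) lo (deduplicate-! _≟_ (U A)) (∈-deduplicate⁻ _≟_ (U A))

sortedElements-unique : ∀ {A} → FLO A → Unique (sortedElements A)
sortedElements-unique {A} lo =
  sorted-unique _ lo (proj₂ (sortedElements-enumerates A)) (sortedElements-sorted lo)

sortedElements-profile : ∀ {A} → FLO A → profile (R A) (sortedElements A) ≡ chain ∣ A ∣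
sortedElements-profile {A} lo = begin
  profile (R A) (sortedElements A) ≡⟨ sorted-profile _ lo (proj₂ (sortedElements-enumerates A))
                                                           (sortedElements-sorted lo) ⟩
  chain (length (sortedElements A)) ≡⟨ cong chain (length-sort (R A) (dedup (U A))) ⟩
  chain ∣ A ∣                       ∎
  where open ≡-Reasoning

FLO-iso : ∀ {A B} → FLO A → FLO B → ∣ A ∣ ≡ ∣ B ∣ → A ≅ B
FLO-iso {A} {B} loA loB size =
  profile-iso (sortedElements-enumerates A) (sortedElements-unique loA)
              (sortedElements-enumerates B) (sortedElements-unique loB)
              (trans (sortedElements-profile loA)
                     (trans (cong chain size) (sym (sortedElements-profile loB))))

module OrdersToGraphs where

  edgeless : Str → Str
  edgeless A = mkStr (U A) (λ _ _ → false)

  edgeless-FUG : ∀ A → FUG (edgeless A)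
  edgeless-FUG A = (λ _ _ → refl) , (λ _ _ _ _ → refl)

  -- A query (k , a , b) asks for the atom of kind k between a and b; it is
  -- answered as soon as a and b are known to be elements.
  Query : Set
  Query = Bool × ℕ × ℕ

  premises : Query → List Lit
  premises (_ , a , b) = isElement a ∷ isElement b ∷ []

  conclusion : Query → Lit
  conclusion (k , a , b) = literalAt (λ _ _ → false) k a b

  open QueryEnumeration {Q = Query} {Valid = λ _ → ⊤} (λ _ → yes tt) premises conclusion

  satisfiable-premises : ∀ q → ⊤ → Σ Str λ S → All (Holds S) (premises q)
  satisfiable-premises (_ , a , b) _ =
    S , isElement-intro S (here refl) ∷ isElement-intro S (there (here refl)) ∷ []
    where
    S : Str
    S = mkStr (a ∷ b ∷ []) (λ _ _ → false)

  image : ∀ A → Realizes enumeration A (edgeless A)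
  image A φ = mk⇔ sound complete
    where
    sound : Fires enumeration A φ → Holds (edgeless A) φ
    sound fires with fires-sound A φ fires
    ... | (k , a , b) , _ , (a∈ , _) ∷ (b∈ , _) ∷ [] , refl = holds-literalAt (edgeless A) k a∈ b∈
    complete : Holds (edgeless A) φ → Fires enumeration A φ
    complete h with holds-elim (edgeless A) (proj₁ φ) (proj₂ φ) h
    ... | src∈ , tgt∈ , _ = subst (Fires enumeration A) (literal-eta (edgeless A) h)
      (fires-complete A (isEq (proj₁ φ) , source (proj₁ φ) , target (proj₁ φ)) tt
        (isElement-intro A src∈ ∷ isElement-intro A tgt∈ ∷ []))

  -- An isomorphism of orders is in particular a bijection of universes;
  -- conversely edgeless graphs of equal size have orders of equal size.
  iso⇔ : ∀ A A' → FLO A → FLO A' → (A ≅ A') ⇔ (edgeless A ≅ edgeless A')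
  iso⇔ A A' loA loA' = mk⇔
    (λ i → let open _≅_ i in
      record { f = f ; g = g ; f∈ = f∈ ; g∈ = g∈ ; gf = gf ; fg = fg ; pres = λ _ _ _ _ → refl })
    (λ j → FLO-iso loA loA' (≅⇒∣∣≡ j))

  FLO≤cFUG : FLO ≤c FUG
  FLO≤cFUG = enumeration , embedding-via-image enumeration edgeless
    (satisfiable satisfiable-premises) (λ A _ → edgeless-FUG A , image A) iso⇔

listsUpTo : ℕ → List ℕ → List (List ℕ)
listsUpTo zero    V = [] ∷ []
listsUpTo (suc k) V = [] ∷ concatMap (λ x → map (x ∷_) (listsUpTo k V)) V

#lists : ℕ → ℕ → ℕ
#lists zero    m = 1
#lists (suc k) m = suc (m * #lists k m)

instance
  #lists-nonZero : ∀ {k m} → NonZero (#lists k m)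
  #lists-nonZero {zero}  = _
  #lists-nonZero {suc k} = _

#lists-mono : ∀ {k k' m m'} → k ≤ k' → m ≤ m' → #lists k m ≤ #lists k' m'
#lists-mono {zero}  {k'} {m' = m'} _ _ = >-nonZero⁻¹ (#lists k' m')
#lists-mono {suc k} {suc k'} (s≤s k≤k') m≤m' = s≤s (*-mono-≤ m≤m' (#lists-mono k≤k' m≤m'))

length-concatMap-constant : ∀ {A B : Set} (f : A → List B) n xs → (∀ x → length (f x) ≡ n) →
                            length (concatMap f xs) ≡ length xs * n
length-concatMap-constant f n []       _ = refl
length-concatMap-constant f n (x ∷ xs) h =
  trans (length-++ (f x)) (cong₂ _+_ (h x) (length-concatMap-constant f n xs h))

length-listsUpTo : ∀ k V → length (listsUpTo k V) ≡ #lists k (length V)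
length-listsUpTo zero    V = refl
length-listsUpTo (suc k) V = cong suc (length-concatMap-constant _ _ V
  (λ x → trans (length-map (x ∷_) (listsUpTo k V)) (length-listsUpTo k V)))

∈-listsUpTo⁺ : ∀ k V t → (∀ {x} → x ∈ t → x ∈ V) → length t ≤ k → t ∈ listsUpTo k V
∈-listsUpTo⁺ zero    V []      _  _       = here refl
∈-listsUpTo⁺ (suc k) V []      _  _       = here refl
∈-listsUpTo⁺ (suc k) V (x ∷ s) t⊆ (s≤s p) =
  there (∈-concatMap⁺ (λ y → map (y ∷_) (listsUpTo k V))
    (lose (t⊆ (here refl)) (∈-map⁺ (x ∷_) (∈-listsUpTo⁺ k V s (λ q → t⊆ (there q)) p))))

∈-listsUpTo⁻ : ∀ k V {t} → t ∈ listsUpTo k V → ∀ {x} → x ∈ t → x ∈ V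
∈-listsUpTo⁻ zero    V (here refl) ()
∈-listsUpTo⁻ (suc k) V (here refl) ()
∈-listsUpTo⁻ (suc k) V (there p) q
  with find (∈-concatMap⁻ (λ x → map (x ∷_) (listsUpTo k V)) {xs = V} p)
... | y , y∈V , r with ∈-map⁻ (y ∷_) r
...   | s , s∈ , refl with q
...     | here refl = y∈V
...     | there q'  = ∈-listsUpTo⁻ k V s∈ q'

injectiveLists : List ℕ → List (List ℕ)
injectiveLists V = filter unique? (listsUpTo (length V) V)

∈-injectiveLists⁺ : ∀ V {t} → Unique t → (∀ {x} → x ∈ t → x ∈ V) → t ∈ injectiveLists V
∈-injectiveLists⁺ V {t} !t t⊆ =
  ∈-filter⁺ unique? (∈-listsUpTo⁺ (length V) V t t⊆ (pigeonhole (λ x → x) !t (λ _ _ e → e) t⊆)) !t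

∈-injectiveLists⁻ : ∀ V {t} → t ∈ injectiveLists V → Unique t × (∀ {x} → x ∈ t → x ∈ V)
∈-injectiveLists⁻ V p with ∈-filter⁻ unique? {xs = listsUpTo (length V) V} p
... | q , !t = !t , ∈-listsUpTo⁻ (length V) V q

length-injectiveLists : ∀ V → length (injectiveLists V) ≤ #lists (length V) (length V)
length-injectiveLists V =
  ≤-trans (length-filter unique? (listsUpTo (length V) V)) (≤-reflexive (length-listsUpTo (length V) V))

-- A structure whose
-- most complicated tuple has code M will get between weight M and
-- weight (suc M) elements, so the size of its image recovers M.
weight : ℕ → ℕ
weight zero    = 1
weight (suc m) = suc (#lists m m * weight m)

weight-step : ∀ m → weight m < weight (suc m)
weight-step m = s≤s (m≤n*m (weight m) (#lists m m))

weight-mono : ∀ {m n} → m ≤ n → weight m ≤ weight n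
weight-mono {n = zero}  z≤n = ≤-refl
weight-mono {n = suc n} m≤1+n with m≤n⇒m<n∨m≡n m≤1+n
... | inj₁ (s≤s m≤n) = ≤-trans (weight-mono m≤n) (<⇒≤ (weight-step n))
... | inj₂ refl      = ≤-refl

weight-determines : ∀ {M M' N} → weight M ≤ N → N < weight (suc M) →
                    weight M' ≤ N → N < weight (suc M') → M ≡ M'
weight-determines {M} {M'} lo hi lo' hi' with <-cmp M M'
... | tri≈ _ M≡M' _ = M≡M'
... | tri< M<M' _ _ = ⊥-elim (<-irrefl refl (<-≤-trans hi (≤-trans (weight-mono M<M') lo')))
... | tri> _ _ M'<M = ⊥-elim (<-irrefl refl (<-≤-trans hi' (≤-trans (weight-mono M'<M) lo)))

module StructuresToOrders where

  code : (ℕ → ℕ → Bool) → List ℕ → ℕ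
  code r t = encode (profile r t)

  code-step : ∀ r x t → code r t < code r (x ∷ t)
  code-step r x t = encodeList-step encode (r x x , map (link r x) t) (profile r t)

  length≤code : ∀ r t → length t ≤ code r t
  length≤code r t = subst (_≤ code r t) (length-profile r t) (length≤encodeList encode (profile r t))

  code-map : ∀ r r' (f : ℕ → ℕ) t → (∀ {a b} → a ∈ t → b ∈ t → r a b ≡ r' (f a) (f b)) →
             code r' (map f t) ≡ code r t
  code-map r r' f t h = cong encode (profile-map r r' f t h)

  code-cong : ∀ r r' t → (∀ {a b} → a ∈ t → b ∈ t → r a b ≡ r' a b) → code r t ≡ code r' t
  code-cong r r' t h = cong encode (profile-cong r r' t h)

  -- A cell is a natural number naming the i-th copy of a tuple t.
  cell : List ℕ → ℕ → ℕ
  cell t i = encode (t , i)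

  cell-injective : ∀ {t t' i j} → cell t i ≡ cell t' j → (t , i) ≡ (t' , j)
  cell-injective = encode-injective

  record Cell (A : Str) (c : ℕ) : Set where
    constructor mkCell
    field
      tuple  : List ℕ
      index  : ℕ
      named  : c ≡ cell tuple index
      unique : Unique tuple
      ⊆U     : ∀ {x} → x ∈ tuple → x ∈ U A
      below  : index < weight (code (R A) tuple)

  elements : Str → List ℕ
  elements A = dedup (U A)

  copiesUpTo : ℕ → List ℕ → List ℕ
  copiesUpTo n t = map (cell t) (upTo n)

  length-copiesUpTo : ∀ n t → length (copiesUpTo n t) ≡ n
  length-copiesUpTo n t = trans (length-map (cell t) (upTo n)) (length-upTo n)

  copies : (ℕ → ℕ → Bool) → List ℕ → List ℕ
  copies r t = copiesUpTo (weight (code r t)) t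

  cells : Str → List ℕ
  cells A = concatMap (copies (R A)) (injectiveLists (elements A))

  ∈-cells⁺ : ∀ A {c} → Cell A c → c ∈ cells A
  ∈-cells⁺ A (mkCell t i refl !t t⊆ i<) =
    ∈-concatMap⁺ (copies (R A)) (lose
      (∈-injectiveLists⁺ (elements A) !t (λ p → ∈-deduplicate⁺ _≟_ (t⊆ p)))
      (∈-map⁺ (cell t) (∈-upTo⁺ i<)))

  ∈-cells⁻ : ∀ A {c} → c ∈ cells A → Cell A c
  ∈-cells⁻ A p with find (∈-concatMap⁻ (copies (R A)) {xs = injectiveLists (elements A)} p)
  ... | t , t∈ , q with ∈-map⁻ (cell t) q | ∈-injectiveLists⁻ (elements A) t∈
  ...   | i , i∈ , refl | !t , t⊆ =
    mkCell t i refl !t (λ r → ∈-deduplicate⁻ _≟_ (U A) (t⊆ r)) (∈-upTo⁻ i∈)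

  ordered : Str → Str
  ordered A = mkStr (cells A) _<ᵇ_

  <ᵇ-true : ∀ {m n} → m < n → (m <ᵇ n) ≡ true
  <ᵇ-true m<n = Equivalence.to T-≡ (<⇒<ᵇ m<n)

  <ᵇ-true⁻ : ∀ {m n} → (m <ᵇ n) ≡ true → m < n
  <ᵇ-true⁻ {m} {n} e = <ᵇ⇒< m n (Equivalence.from T-≡ e)

  <ᵇ-FLO : ∀ V → FLO (mkStr V _<ᵇ_)
  <ᵇ-FLO V = irreflexive , transitive , total
    where
    irreflexive : ∀ a → a ∈ V → (a <ᵇ a) ≡ false
    irreflexive a _ with a <ᵇ a in a<a
    ... | false = refl
    ... | true  = ⊥-elim (<-irrefl refl (<ᵇ-true⁻ {a} a<a))
    transitive : ∀ a b c → a ∈ V → b ∈ V → c ∈ V →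
                 (a <ᵇ b) ≡ true → (b <ᵇ c) ≡ true → (a <ᵇ c) ≡ true
    transitive a b c _ _ _ a<b b<c = <ᵇ-true (<-trans (<ᵇ-true⁻ {a} {b} a<b) (<ᵇ-true⁻ {b} {c} b<c))
    total : ∀ a b → a ∈ V → b ∈ V → (a ≡ b) ⊎ ((a <ᵇ b) ≡ true) ⊎ ((b <ᵇ a) ≡ true)
    total a b _ _ with <-cmp a b
    ... | tri< a<b _ _ = inj₂ (inj₁ (<ᵇ-true a<b))
    ... | tri≈ _ a≡b _ = inj₁ a≡b
    ... | tri> _ _ b<a = inj₂ (inj₂ (<ᵇ-true b<a))

  edgeRel : List (ℕ × ℕ) → ℕ → ℕ → Bool
  edgeRel E a b = does ((a , b) ∈²? E)

  related? : (r : ℕ → ℕ → Bool) → Decidable (λ (p : ℕ × ℕ) → T (r (proj₁ p) (proj₂ p)))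
  related? r p = T? (r (proj₁ p) (proj₂ p))

  edges : (ℕ → ℕ → Bool) → List ℕ → List (ℕ × ℕ)
  edges r w = filter (related? r) (cartesianProduct w w)

  edgeRel-edges : ∀ r w {a b} → a ∈ w → b ∈ w → edgeRel (edges r w) a b ≡ r a b
  edgeRel-edges r w {a} {b} a∈ b∈ with (a , b) ∈²? edges r w | r a b in rab
  ... | yes p | _     =
    sym (Equivalence.to T-≡ (subst T rab (proj₂ (∈-filter⁻ (related? r) {xs = cartesianProduct w w} p))))
  ... | no ¬p | true  =
    ⊥-elim (¬p (∈-filter⁺ (related? r) (∈-cartesianProduct⁺ a∈ b∈) (Equivalence.from T-≡ rab)))
  ... | no ¬p | false = refl

  edges-agree : ∀ r w {t} → (∀ {x} → x ∈ t → x ∈ w) →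
                ∀ {a b} → a ∈ t → b ∈ t → r a b ≡ edgeRel (edges r w) a b
  edges-agree r w t⊆ p q = sym (edgeRel-edges r w (t⊆ p) (t⊆ q))

  describe : (ℕ → ℕ → Bool) → List ℕ → List Lit
  describe r t = map isElement t ++ map relationLiteral (cartesianProduct t t)
    where
    relationLiteral : ℕ × ℕ → Lit
    relationLiteral (x , y) = (relA x y , r x y)

  describe-holds⁺ : ∀ S r t → (∀ {x} → x ∈ t → x ∈ U S) →
                    (∀ {x y} → x ∈ t → y ∈ t → R S x y ≡ r x y) → All (Holds S) (describe r t)
  describe-holds⁺ S r t t⊆ rel = All.++⁺
    (All.map⁺ (All.tabulate λ p → isElement-intro S (t⊆ p)))
    (All.map⁺ (All.tabulate λ p →
      let (x∈ , y∈) = ∈-cartesianProduct⁻ t t p in t⊆ x∈ , t⊆ y∈ , rel x∈ y∈))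

  describe-holds⁻ : ∀ S r t → All (Holds S) (describe r t) →
                    (∀ {x} → x ∈ t → x ∈ U S) × (∀ {x y} → x ∈ t → y ∈ t → R S x y ≡ r x y)
  describe-holds⁻ S r t h =
    (λ p → proj₁ (All.lookup (All.map⁻ (All.++⁻ˡ (map isElement t) h)) p)) ,
    (λ p q → proj₂ (proj₂ (All.lookup (All.map⁻ (All.++⁻ʳ (map isElement t) h))
                                      (∈-cartesianProduct⁺ p q))))

  Side : Set
  Side = List ℕ × ℕ

  -- A query consists of two sides, a relation E on the union of their
  -- tuples, and the kind of atom asked for between the two cells.
  Query : Set
  Query = Side × Side × List (ℕ × ℕ) × Bool

  ValidSide : List (ℕ × ℕ) → Side → Set
  ValidSide E (t , i) = Unique t × i < weight (code (edgeRel E) t)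

  Valid : Query → Set
  Valid (s , s' , E , _) = ValidSide E s × ValidSide E s'

  valid? : Decidable Valid
  valid? ((t , i) , (t' , j) , E , _) =
    (unique? t ×-dec (i <? _)) ×-dec (unique? t' ×-dec (j <? _))

  premises : Query → List Lit
  premises ((t , _) , (t' , _) , E , _) = describe (edgeRel E) t ++ describe (edgeRel E) t'

  conclusion : Query → Lit
  conclusion ((t , i) , (t' , j) , _ , k) = literalAt _<ᵇ_ k (cell t i) (cell t' j)

  open QueryEnumeration valid? premises conclusion

  satisfiable-premises : ∀ q → Valid q → Σ Str λ S → All (Holds S) (premises q)
  satisfiable-premises ((t , _) , (t' , _) , E , _) _ = S , All.++⁺
    (describe-holds⁺ S (edgeRel E) t (∈-++⁺ˡ) (λ _ _ → refl))
    (describe-holds⁺ S (edgeRel E) t' (∈-++⁺ʳ t) (λ _ _ → refl))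
    where
    S : Str
    S = mkStr (t ++ t') (edgeRel E)

  side-cell : ∀ A E t i → ValidSide E (t , i) → All (Holds A) (describe (edgeRel E) t) →
              Cell A (cell t i)
  side-cell A E t i (!t , i<) h with describe-holds⁻ A (edgeRel E) t h
  ... | t⊆ , rel =
    mkCell t i refl !t t⊆ (subst (λ m → i < weight m) (sym (code-cong (R A) (edgeRel E) t rel)) i<)

  cellQuery : ∀ A {c d} → Cell A c → Cell A d → Bool → Query
  cellQuery A (mkCell t i _ _ _ _) (mkCell t' j _ _ _ _) k =
    (t , i) , (t' , j) , edges (R A) (t ++ t') , k

  cellQuery-valid : ∀ A {c d} (γ : Cell A c) (δ : Cell A d) k → Valid (cellQuery A γ δ k)
  cellQuery-valid A (mkCell t i _ !t _ i<) (mkCell t' j _ !t' _ j<) k =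
    (!t  , subst (λ m → i < weight m) (code-cong _ _ t  (edges-agree (R A) (t ++ t') ∈-++⁺ˡ)) i<) ,
    (!t' , subst (λ m → j < weight m) (code-cong _ _ t' (edges-agree (R A) (t ++ t') (∈-++⁺ʳ t))) j<)

  cellQuery-premises : ∀ A {c d} (γ : Cell A c) (δ : Cell A d) k →
                       All (Holds A) (premises (cellQuery A γ δ k))
  cellQuery-premises A (mkCell t i _ _ t⊆ _) (mkCell t' j _ _ t'⊆ _) k = All.++⁺
    (describe-holds⁺ A _ t  t⊆  (edges-agree (R A) (t ++ t') ∈-++⁺ˡ))
    (describe-holds⁺ A _ t' t'⊆ (edges-agree (R A) (t ++ t') (∈-++⁺ʳ t)))

  cellQuery-conclusion : ∀ A {c d} (γ : Cell A c) (δ : Cell A d) k →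
                         conclusion (cellQuery A γ δ k) ≡ literalAt _<ᵇ_ k c d
  cellQuery-conclusion A (mkCell _ _ refl _ _ _) (mkCell _ _ refl _ _ _) k = refl

  image : ∀ A → Realizes enumeration A (ordered A)
  image A φ = mk⇔ sound complete
    where
    sound : Fires enumeration A φ → Holds (ordered A) φ
    sound fires with fires-sound A φ fires
    ... | ((t , i) , (t' , j) , E , k) , (vs , vs') , h , refl = holds-literalAt (ordered A) k
      (∈-cells⁺ A (side-cell A E t  i vs  (All.++⁻ˡ (describe (edgeRel E) t) h)))
      (∈-cells⁺ A (side-cell A E t' j vs' (All.++⁻ʳ (describe (edgeRel E) t) h)))
    complete : Holds (ordered A) φ → Fires enumeration A φ
    complete h with holds-elim (ordered A) (proj₁ φ) (proj₂ φ) h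
    ... | src∈ , tgt∈ , _ =
      subst (Fires enumeration A) (trans (cellQuery-conclusion A γ δ k) (literal-eta (ordered A) h))
        (fires-complete A (cellQuery A γ δ k) (cellQuery-valid A γ δ k) (cellQuery-premises A γ δ k))
      where
      γ : Cell A (source (proj₁ φ))
      γ = ∈-cells⁻ A src∈
      δ : Cell A (target (proj₁ φ))
      δ = ∈-cells⁻ A tgt∈
      k : Bool
      k = isEq (proj₁ φ)

  uncell : ℕ → List ℕ × ℕ
  uncell = decode

  relabel : (ℕ → ℕ) → ℕ → ℕ
  relabel f c = cell (map f (proj₁ (uncell c))) (proj₂ (uncell c))

  relabel-cell : ∀ f t i → relabel f (cell t i) ≡ cell (map f t) i
  relabel-cell f t i = cong (λ p → cell (map f (proj₁ p)) (proj₂ p)) (decode-encode (t , i))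

  cell-≅ : ∀ {A A'} (iso : A ≅ A') {c} → Cell A c → Cell A' (relabel (_≅_.f iso) c)
  cell-≅ {A} {A'} iso (mkCell t i refl !t t⊆ i<) = mkCell (map f t) i (relabel-cell f t i)
    (map-unique f !t (λ p q e → trans (sym (gf _ (t⊆ p))) (trans (cong g e) (gf _ (t⊆ q)))))
    (λ p → let (a , a∈ , e) = ∈-map⁻ f p in subst (_∈ U A') (sym e) (f∈ a (t⊆ a∈)))
    (subst (λ m → i < weight m) (sym (code-map (R A) (R A') f t (λ p q → pres _ _ (t⊆ p) (t⊆ q)))) i<)
    where open _≅_ iso

  relabel-inverse : ∀ {A A'} (iso : A ≅ A') {c} → Cell A c →
                    relabel (_≅_.g iso) (relabel (_≅_.f iso) c) ≡ c
  relabel-inverse {A} iso (mkCell t i refl _ t⊆ _) = begin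
    relabel g (relabel f (cell t i)) ≡⟨ cong (relabel g) (relabel-cell f t i) ⟩
    relabel g (cell (map f t) i)     ≡⟨ relabel-cell g (map f t) i ⟩
    cell (map g (map f t)) i          ≡⟨ cong (λ s → cell s i) (sym (map-∘ t)) ⟩
    cell (map (λ a → g (f a)) t) i    ≡⟨ cong (λ s → cell s i) (map-id-local (All.tabulate λ p → gf _ (t⊆ p))) ⟩
    cell t i                          ∎
    where open _≅_ iso
          open ≡-Reasoning

  ordered-size-≅ : ∀ {A A'} → A ≅ A' → ∣ ordered A ∣ ≡ ∣ ordered A' ∣
  ordered-size-≅ {A} {A'} iso = bijection⇒dedup-length record
    { to      = relabel f
    ; from    = relabel g
    ; to∈     = λ p → ∈-cells⁺ A' (cell-≅ iso (∈-cells⁻ A p))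
    ; from∈   = λ p → ∈-cells⁺ A (cell-≅ (≅-sym iso) (∈-cells⁻ A' p))
    ; from-to = λ p → relabel-inverse iso (∈-cells⁻ A p)
    ; to-from = λ p → relabel-inverse (≅-sym iso) (∈-cells⁻ A' p)
    }
    where open _≅_ iso

  -- The size of ordered A is pinned down by the largest code M of a
  -- duplicate-free tuple of A, attained by a tuple best listing all of A.
  module Bounds (A : Str) where

    tuples : List (List ℕ)
    tuples = injectiveLists (elements A)

    ∈-tuples : ∀ {t} → Unique t → (∀ {x} → x ∈ t → x ∈ U A) → t ∈ tuples
    ∈-tuples !t t⊆ = ∈-injectiveLists⁺ (elements A) !t (λ p → ∈-deduplicate⁺ _≟_ (t⊆ p))

    best : List ℕ
    best = argmax (code (R A)) [] tuples

    M : ℕ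
    M = code (R A) best

    best∈ : best ∈ tuples
    best∈ = argmax-all (code (R A)) (∈-tuples [] (λ ())) (All.tabulate (λ p → p))

    code≤M : ∀ {t} → t ∈ tuples → code (R A) t ≤ M
    code≤M = All.lookup (f[xs]≤f[argmax] {f = code (R A)} [] tuples)

    best-unique : Unique best
    best-unique = proj₁ (∈-injectiveLists⁻ (elements A) best∈)

    -- best lists every element: otherwise extending it would raise its code.
    best⊆U : ∀ {a} → a ∈ best → a ∈ U A
    best⊆U p = ∈-deduplicate⁻ _≟_ (U A) (proj₂ (∈-injectiveLists⁻ (elements A) best∈) p)

    extend : ∀ {a} → a ∈ U A → a ∉ best → (a ∷ best) ∈ tuples
    extend {a} a∈ a∉best = ∈-tuples
      (All.tabulate (λ p a≡b → a∉best (subst (_∈ best) (sym a≡b) p)) ∷ best-unique)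
      (λ { (here refl) → a∈ ; (there p) → best⊆U p })

    best-enumerates : Enumerates A best
    best-enumerates = U⊆best , best⊆U
      where
      U⊆best : ∀ {a} → a ∈ U A → a ∈ best
      U⊆best {a} a∈ with a ∈? best
      ... | yes a∈best = a∈best
      ... | no  a∉best =
        ⊥-elim (<-irrefl refl (<-≤-trans (code-step (R A) a best) (code≤M (extend a∈ a∉best))))

    -- The weight M copies of best are distinct cells.
    size-lower : weight M ≤ ∣ ordered A ∣
    size-lower = subst (_≤ ∣ ordered A ∣) (length-copiesUpTo (weight M) best)
      (pigeonhole (λ c → c) copies-unique (λ _ _ e → e) copy∈)
      where
      copies-unique : Unique (copiesUpTo (weight M) best)
      copies-unique = Unique.map⁺ (λ e → cong proj₂ (cell-injective {best} {best} e)) (Unique.upTo⁺ (weight M))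
      copy∈ : ∀ {c} → c ∈ copiesUpTo (weight M) best → c ∈ dedup (cells A)
      copy∈ p with ∈-map⁻ (cell best) p
      ... | i , i∈ , refl =
        ∈-deduplicate⁺ _≟_ (∈-cells⁺ A (mkCell best i refl best-unique best⊆U (∈-upTo⁻ i∈)))

    elements≤M : length (elements A) ≤ M
    elements≤M = ≤-trans (length≤code (R A) (elements A))
      (code≤M (∈-tuples (deduplicate-! _≟_ (U A)) (∈-deduplicate⁻ _≟_ (U A))))

    -- Every cell is among the weight M copies of one of the at most
    -- #lists M M tuples.
    size-upper : ∣ ordered A ∣ < weight (suc M)
    size-upper = s≤s (begin
      ∣ ordered A ∣            ≤⟨ pigeonhole (λ c → c) (deduplicate-! _≟_ (cells A)) (λ _ _ e → e) cell∈ ⟩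
      length allCopies         ≡⟨ length-concatMap-constant _ (weight M) tuples (length-copiesUpTo (weight M)) ⟩
      length tuples * weight M ≤⟨ *-monoˡ-≤ (weight M) #tuples≤ ⟩
      #lists M M * weight M    ∎)
      where
      open ≤-Reasoning
      allCopies : List ℕ
      allCopies = concatMap (copiesUpTo (weight M)) tuples
      #tuples≤ : length tuples ≤ #lists M M
      #tuples≤ = ≤-trans (length-injectiveLists (elements A)) (#lists-mono elements≤M elements≤M)
      cell∈ : ∀ {c} → c ∈ dedup (cells A) → c ∈ allCopies
      cell∈ p with ∈-cells⁻ A (∈-deduplicate⁻ _≟_ (cells A) p)
      ... | mkCell t i refl !t t⊆ i< = ∈-concatMap⁺ (copiesUpTo (weight M)) (lose (∈-tuples !t t⊆)
              (∈-map⁺ (cell t) (∈-upTo⁺ (<-≤-trans i< (weight-mono (code≤M (∈-tuples !t t⊆)))))))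

  -- Images of equal size have the same maximal code, hence the tuples best
  -- have equal profiles, and so the structures are isomorphic.
  reflect : ∀ A A' → ordered A ≅ ordered A' → A ≅ A'
  reflect A A' j = profile-iso X.best-enumerates X.best-unique Y.best-enumerates Y.best-unique
    (encode-injective (weight-determines X.size-lower X.size-upper
      (subst (weight Y.M ≤_) (sym size≡) Y.size-lower)
      (subst (_< weight (suc Y.M)) (sym size≡) Y.size-upper)))
    where
    module X = Bounds A
    module Y = Bounds A'
    size≡ : ∣ ordered A ∣ ≡ ∣ ordered A' ∣
    size≡ = ≅⇒∣∣≡ j

  iso⇔ : ∀ A A' → (A ≅ A') ⇔ (ordered A ≅ ordered A')
  iso⇔ A A' = mk⇔ (λ i → FLO-iso (<ᵇ-FLO (cells A)) (<ᵇ-FLO (cells A')) (ordered-size-≅ i)) (reflect A A')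

  -- The construction never looks at the class: every class of finite
  -- structures in this language is ≤c FLO.
  ≤cFLO : ∀ K → K ≤c FLO
  ≤cFLO K = enumeration , embedding-via-image enumeration ordered
    (satisfiable satisfiable-premises) (λ A _ → <ᵇ-FLO (cells A) , image A) (λ A A' _ _ → iso⇔ A A')

theorem2p5 : (FUG ≤c FLO) × (FLO ≤c FUG)
theorem2p5 = StructuresToOrders.≤cFLO FUG , OrdersToGraphs.FLO≤cFUG
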